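{- Let $\mathcal{A}$ be an updatable timed automaton, let $\mathcal{G}_1$ be its smallest (non-reduced) $\mathcal{G}$-map and let $\mathcal{G}_2$ be its smallest reduced $\mathcal{G}$-map. If $\mathcal{G}_1$ is finite, then $\mathcal{G}_2$ is also finite. Moreover, $LU(\mathcal{G}_2)\le LU(\mathcal{G}_1)$ and $\mathcal{G}_2^d\subseteq\mathcal{G}_1^d$.
   Context: Clocks and constraints. $X$ is a finite set of clocks; a valuation is a map $v:X\to\mathbb{R}_{\ge 0}$; $\mathbb{V}$ is the set of valuations. Below $\triangleleft,\triangleleft_1$ each denote one of $<,\le$ (not necessarily the same). An atomic constraint is a non-diagonal constraint $x\triangleleft c$ or $c\triangleleft x$, a diagonal constraint $x-y\triangleleft c$ or $c\triangleleft x-y$ (with $x,y\in X$, $c\in\mathbb{N}$), or one of $\top$ (true), $\bot$ (false). A constraint (guard) is a finite conjunction of atomic constraints; "$g$ contains $\psi$" means $\psi$ is one of the atomic conjuncts of $g$. Updates. An update $up$ assigns to each clock $x$ an expression $up_x$ which is either $c$ with $c\in\mathbb{N}$ or $y+d$ with $y\in X$ (possibly $y=x$), $d\in\mathbb{Z}$. UTA. An updatable timed automaton (UTA) $\mathcal{A}=(Q,X,q_0,T,F)$ has a finite set $Q$ of states, a finite set $X$ of clocks, initial state $q_0$, finite set $T$ of transitions $(q,g,up,q')$ (source $q$, guard $g$, update $up$, target $q'$), and accepting states $F\subseteq Q$. Inverse update. $up^{ -1}(\varphi)$ is obtained from $\varphi$ by simultaneously substituting $up_x$ for every clock $x$, and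 rewriting the result into an equivalent (over $\mathbb{V}$) constraint built from atomic constraints of the forms $x\triangleleft c$, $c\triangleleft x$, $x-y\triangleleft c$, $c\triangleleft x-y$ (with $x,y\in X$, $c\in\mathbb{N}$), $\top$, $\bot$: constants are collected on one side; for $c>0$, $x-y\triangleleft -c$ is rewritten $c\triangleleft y-x$ and $-c\triangleleft x-y$ is rewritten $y-x\triangleleft c$; results equivalent over $\mathbb{V}$ to true or false (e.g. $0\le x$, or $x\le -1$) are identified with $\top$, resp. $\bot$. Pre. For a guard $g$, update $up$ and atomic constraint $\varphi$, the atomic constraint $\mathrm{pre}(\varphi,g,up)$ is defined by: (1) if $up^{ -1}(\varphi)$ is $x\triangleleft d$ and $g$ contains some $x\triangleleft_1 c$, then it is $\top$; (2) if $up^{ -1}(\varphi)$ is $d\triangleleft x$ and $g$ contains some $x\triangleleft_1 c$ with $c<d$, then it is $c\le x$ (if several such $c$ exist, one is fixed); (3) if $up^{ -1}(\varphi)$ is $x-y\triangleleft d$ or $d\triangleleft x-y$, and $g$ contains some $x\triangleleft_1 c$ with $c<d$, or some $x-y\triangleleft_1 c$ with $c<d$, or some $e\triangleleft_1 x-y$ with $d<e$, then it is $\top$; in all other cases it is $up^{ -1}(\varphi)$. $\mathcal{G}$-maps. A (non-reduced) $\mathcal{G}$-map for $\mathcal{A}$ is a family $(\mathcal{G}(q))_{q\in Q}$ of sets of atomic constraints such that for every transition $(q,g,up,q')\in T$: every atomic constraint of $g$ belongs to $\mathcal{G}(q)$; $up^{ -1}(0\le x)\in\mathcal{G}(q)$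 for every $x\in X$; and $up^{ -1}(\varphi)\in\mathcal{G}(q)$ for every $\varphi\in\mathcal{G}(q')$. A reduced $\mathcal{G}$-map is a family satisfying the same three conditions with $up^{ -1}(0\le x)$ and $up^{ -1}(\varphi)$ replaced by $\mathrm{pre}(0\le x,g,up)$ and $\mathrm{pre}(\varphi,g,up)$. Both kinds of families are closed under pointwise intersection, so there is a smallest one of each kind for pointwise inclusion. A family is finite if every $\mathcal{G}(q)$ is finite. $LU$ and diagonal parts. For a finite set $G$ of atomic constraints let $G^{nd}$ and $G^{d}$ be its subsets of non-diagonal and diagonal constraints. Define $L(G),U(G):X\to\mathbb{N}\cup\{ -\infty\}$ by $L(G)(x)=\max\{c\mid (c\triangleleft x)\in G^{nd}\}$ and $U(G)(x)=\max\{c\mid (x\triangleleft c)\in G^{nd}\}$, with value $-\infty$ if there is no such constraint. Write $LU(\mathcal{G}_2)\le LU(\mathcal{G}_1)$ if for every state $q$ and clock $x$, $L(\mathcal{G}_2(q))(x)\le L(\mathcal{G}_1(q))(x)$ and $U(\mathcal{G}_2(q))(x)\le U(\mathcal{G}_1(q))(x)$. Write $\mathcal{G}_2^d\subseteq\mathcal{G}_1^d$ if $\mathcal{G}_2(q)^d\subseteq\mathcal{G}_1(q)^d$ for every $q$. -}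

module Defs where

open import Data.Bool.Base using (if_then_else_)
open import Data.Fin.Base using (Fin)
import Data.Fin.Properties as Fin
open import Data.Fin.Subset using (Subset)
open import Data.Integer.Base using (ℤ; +_; -[1+_]; _+_; _-_)
import Data.Integer.Properties as ℤ
open import Data.List.Base using (List; map)
import Data.List.Extrema as Extrema
open import Data.List.Membership.Propositional using (_∈_)
open import Data.List.Relation.Unary.All using (All)
open import Data.Nat.Base as ℕ using (ℕ; zero; suc)
import Data.Nat.Properties as ℕ
open import Data.Product.Base using (∃; _×_; proj₁)
open import Data.Sum.Base using (_⊎_)
open import Level using (0ℓ)
open import Relation.Binary.Bundles using (TotalOrder)
import Relation.Binary.Construct.Add.Infimum.NonStrict as AddInfimum
open import Relation.Binary.PropositionalEquality using (_≡_)
open import Relation.Nullary using (¬_; does)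
open import Relation.Nullary.Construct.Add.Infimum using (_₋; ⊥₋; [_])
open import Relation.Unary as Pred using (Pred; _≐_; _∩_)

data Ineq : Set where
  strict : Ineq   -- <
  weak   : Ineq   -- ≤

data Atomic (n : ℕ) : Set where
  upper     : Fin n → Ineq → ℕ → Atomic n           -- x ◁ c
  lower     : ℕ → Ineq → Fin n → Atomic n           -- c ◁ x
  diffUpper : Fin n → Fin n → Ineq → ℕ → Atomic n   -- x - y ◁ c
  diffLower : ℕ → Ineq → Fin n → Fin n → Atomic n   -- c ◁ x - y
  ⊤ ⊥       : Atomic n

data Diagonal {n : ℕ} : Pred (Atomic n) 0ℓ where
  diffUpper : ∀ {x y ◁ c} → Diagonal (diffUpper x y ◁ c)
  diffLower : ∀ {x y ◁ c} → Diagonal (diffLower c ◁ x y)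

Guard : ℕ → Set
Guard n = List (Atomic n)

data Expr (n : ℕ) : Set where
  const : ℕ → Expr n
  _⊕_   : Fin n → ℤ → Expr n

Update : ℕ → Set
Update n = Fin n → Expr n

record Transition (states clocks : ℕ) : Set where
  field
    source : Fin states
    guard  : Guard clocks
    update : Update clocks
    target : Fin states

record UTA (states clocks : ℕ) : Set where
  field
    initial     : Fin states
    transitions : List (Transition states clocks)
    accepting   : Subset states

private variable
  m n : ℕ

truth : ℤ → Ineq → ℤ → Atomic n
truth a strict b = if does (a ℤ.<? b) then ⊤ else ⊥
truth a weak   b = if does (a ℤ.≤? b) then ⊤ else ⊥

-- The next four functions give the atomic constraint that is equivalent,
-- over nonnegative valuations, to x ◁ k, k ◁ x, x - y ◁ k and k ◁ x - y
-- respectively, for an integer k.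

normUpper : Fin n → Ineq → ℤ → Atomic n
normUpper x ◁      -[1+ _ ]  = ⊥
normUpper x strict (+ zero)  = ⊥
normUpper x weak   (+ zero)  = upper x weak 0
normUpper x ◁      (+ suc k) = upper x ◁ (suc k)

normLower : ℤ → Ineq → Fin n → Atomic n
normLower -[1+ _ ]  ◁      x = ⊤
normLower (+ zero)  weak   x = ⊤
normLower (+ zero)  strict x = lower 0 strict x
normLower (+ suc k) ◁      x = lower (suc k) ◁ x

-- For distinct clocks x - y takes every real value, so the constraint is
-- never trivial; x - x is the constant 0.
normDiffUpper : Fin n → Fin n → Ineq → ℤ → Atomic n
normDiffUpper x y ◁ k = if does (x Fin.≟ y) then truth (+ 0) ◁ k else flip k
  where
  flip : ℤ → Atomic _
  flip (+ c)    = diffUpper x y ◁ c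
  flip -[1+ c ] = diffLower (suc c) ◁ y x

normDiffLower : ℤ → Ineq → Fin n → Fin n → Atomic n
normDiffLower k ◁ x y = if does (x Fin.≟ y) then truth k ◁ (+ 0) else flip k
  where
  flip : ℤ → Atomic _
  flip (+ c)    = diffLower c ◁ x y
  flip -[1+ c ] = diffUpper y x ◁ (suc c)

-- Normal forms of e ◁ c, c ◁ e, e - e′ ◁ c and c ◁ e - e′ for expressions e, e′.

substUpper : Expr n → Ineq → ℕ → Atomic n
substUpper (const a) ◁ c = truth (+ a) ◁ (+ c)
substUpper (y ⊕ d)   ◁ c = normUpper y ◁ (+ c - d)

substLower : ℕ → Ineq → Expr n → Atomic n
substLower c ◁ (const a) = truth (+ c) ◁ (+ a)
substLower c ◁ (y ⊕ d)   = normLower (+ c - d) ◁ y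

substDiffUpper : Expr n → Expr n → Ineq → ℕ → Atomic n
substDiffUpper (const a) (const b) ◁ c = truth (+ a - + b) ◁ (+ c)
substDiffUpper (const a) (z ⊕ e)   ◁ c = normLower (+ a - e - + c) ◁ z
substDiffUpper (y ⊕ d)   (const b) ◁ c = normUpper y ◁ (+ c + + b - d)
substDiffUpper (y ⊕ d)   (z ⊕ e)   ◁ c = normDiffUpper y z ◁ (+ c - d + e)

substDiffLower : ℕ → Ineq → Expr n → Expr n → Atomic n
substDiffLower c ◁ (const a) (const b) = truth (+ c) ◁ (+ a - + b)
substDiffLower c ◁ (const a) (z ⊕ e)   = normUpper z ◁ (+ a - e - + c)
substDiffLower c ◁ (y ⊕ d)   (const b) = normLower (+ c + + b - d) ◁ y
substDiffLower c ◁ (y ⊕ d)   (z ⊕ e)   = normDiffLower (+ c - d + e) ◁ y z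

_⁻¹_ : Update n → Atomic n → Atomic n
up ⁻¹ upper x ◁ c       = substUpper (up x) ◁ c
up ⁻¹ lower c ◁ x       = substLower c ◁ (up x)
up ⁻¹ diffUpper x y ◁ c = substDiffUpper (up x) (up y) ◁ c
up ⁻¹ diffLower c ◁ x y = substDiffLower c ◁ (up x) (up y)
up ⁻¹ ⊤                 = ⊤
up ⁻¹ ⊥                 = ⊥

data CutsDiff (g : Guard n) (x y : Fin n) (d : ℕ) : Set where
  byUpper     : ∀ {◁₁ c} → upper x ◁₁ c ∈ g       → c ℕ.< d → CutsDiff g x y d
  byDiffUpper : ∀ {◁₁ c} → diffUpper x y ◁₁ c ∈ g → c ℕ.< d → CutsDiff g x y d
  byDiffLower : ∀ {◁₁ e} → diffLower e ◁₁ x y ∈ g → d ℕ.< e → CutsDiff g x y d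

-- Reduces g ψ χ: one of the three reduction rules for guard g applies to ψ
-- and may return χ.
data Reduces (g : Guard n) : Atomic n → Atomic n → Set where
  upper     : ∀ {x ◁ d ◁₁ c} → upper x ◁₁ c ∈ g →
              Reduces g (upper x ◁ d) ⊤
  lower     : ∀ {x ◁ d ◁₁ c} → upper x ◁₁ c ∈ g → c ℕ.< d →
              Reduces g (lower d ◁ x) (lower c weak x)
  diffUpper : ∀ {x y ◁ d} → CutsDiff g x y d → Reduces g (diffUpper x y ◁ d) ⊤
  diffLower : ∀ {x y ◁ d} → CutsDiff g x y d → Reduces g (diffLower d ◁ x y) ⊤

-- Rule `lower` leaves the choice of c open when several are possible, so pre
-- is any function that fixes such choices.
IsPre : (Atomic n → Guard n → Update n → Atomic n) → Set
IsPre {n} pre = ∀ φ g up →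
  Reduces g (up ⁻¹ φ) (pre φ g up) ⊎
  (¬ ∃ (Reduces g (up ⁻¹ φ)) × pre φ g up ≡ up ⁻¹ φ)

Family : ℕ → ℕ → Set₁
Family m n = Fin m → Pred (Atomic n) 0ℓ

record IsClosed (A : UTA m n) (back : Atomic n → Guard n → Update n → Atomic n)
                (𝒢 : Family m n) : Set where
  open UTA A
  open Transition
  field
    guards  : ∀ {t} → t ∈ transitions → All (𝒢 (source t)) (guard t)
    nonneg  : ∀ {t} → t ∈ transitions → ∀ x →
              𝒢 (source t) (back (lower 0 weak x) (guard t) (update t))
    closed  : ∀ {t} → t ∈ transitions → ∀ {φ} → 𝒢 (target t) φ →
              𝒢 (source t) (back φ (guard t) (update t))

IsGMap : UTA m n → Family m n → Set
IsGMap A = IsClosed A (λ φ g up → up ⁻¹ φ)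

IsReducedGMap : UTA m n → (Atomic n → Guard n → Update n → Atomic n) →
                Family m n → Set
IsReducedGMap A pre = IsClosed A pre

IsSmallest : (Family m n → Set) → Family m n → Set₁
IsSmallest P 𝒢 = P 𝒢 × (∀ ℋ → P ℋ → ∀ q → 𝒢 q Pred.⊆ ℋ q)

Finite : Pred (Atomic n) 0ℓ → Set
Finite G = ∃ λ xs → G ≐ (_∈ xs)

FiniteFamily : Family m n → Set
FiniteFamily 𝒢 = ∀ q → Finite (𝒢 q)

-- ℕ ∪ {-∞}, with -∞ the added infimum ⊥₋.
ℕ₋∞ : TotalOrder 0ℓ 0ℓ 0ℓ
ℕ₋∞ = record
  { isTotalOrder = AddInfimum.≤₋-isTotalOrder-≡ ℕ._≤_ ℕ.≤-isTotalOrder }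

open TotalOrder ℕ₋∞ public using () renaming (_≤_ to _≤₋∞_)
open Extrema ℕ₋∞ using (max)

-- The constant of a constraint c ◁ x, resp. x ◁ c, on the given clock x;
-- -∞, the neutral element of max, for any other constraint.

lowerConst : Fin n → Atomic n → ℕ ₋
lowerConst x (lower c _ y) = if does (x Fin.≟ y) then [ c ] else ⊥₋
lowerConst x _             = ⊥₋

upperConst : Fin n → Atomic n → ℕ ₋
upperConst x (upper y _ c) = if does (x Fin.≟ y) then [ c ] else ⊥₋
upperConst x _             = ⊥₋

L : {G : Pred (Atomic n) 0ℓ} → Finite G → Fin n → ℕ ₋
L fin x = max ⊥₋ (map (lowerConst x) (proj₁ fin))

U : {G : Pred (Atomic n) 0ℓ} → Finite G → Fin n → ℕ ₋
U fin x = max ⊥₋ (map (upperConst x) (proj₁ fin))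

LU≤ : {𝒢 ℋ : Family m n} → FiniteFamily 𝒢 → FiniteFamily ℋ → Set
LU≤ fin𝒢 finℋ = ∀ q x →
  L (fin𝒢 q) x ≤₋∞ L (finℋ q) x × U (fin𝒢 q) x ≤₋∞ U (finℋ q) x

_⊆ᵈ_ : Family m n → Family m n → Set
𝒢 ⊆ᵈ ℋ = ∀ q → (𝒢 q ∩ Diagonal) Pred.⊆ (ℋ q ∩ Diagonal)

{-# OPTIONS --safe #-}
-- Let χ ⊑ φ mean that χ is φ, is trivial, or is a weaker lower bound than φ on
-- the same clock.  Every reduction rule yields a result ⊑ its argument, and
-- up ⁻¹_ is monotone for ⊑, so the ⊑-down-closure of 𝒢₁ is closed under pre and
-- contains 𝒢₂.  Going down along ⊑ produces no new diagonal or upper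
-- constraints and no larger lower bounds, and the down-closure of a finite set
-- is finite.  Since finiteness asks for an explicit enumeration, 𝒢₂ is then
-- computed by saturation inside the down-closure of 𝒢₁.
module Submission where

open import Defs
open import Data.Bool.Base using (Bool; true; false)
import Data.Bool.Properties as Bool
open import Data.Fin.Base using (Fin)
import Data.Fin.Properties as Fin
open import Data.Integer.Base as ℤ using (+_; -[1+_]; +<+)
import Data.Integer.Properties as ℤ
open import Data.List.Base
  using (List; []; _∷_; _++_; length; map; filter; concatMap; allFin; upTo; cartesianProductWith)
import Data.List.Extrema as Extrema
open import Data.List.Membership.Propositional using (_∈_; find)
open import Data.List.Membership.Propositional.Properties
  using (∈-map⁺; ∈-filter⁺; ∈-concatMap⁺; ∈-cartesianProductWith⁺; ∈-upTo⁺; ∈-allFin;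
         ∈-map∘filter⁺; ∈-map∘filter⁻)
import Data.List.Membership.DecPropositional as DecMembership
open import Data.List.Properties using (filter-notAll)
open import Data.List.Relation.Unary.All as All using (All; []; _∷_)
import Data.List.Relation.Unary.All.Properties as All
open import Data.List.Relation.Unary.Any as Any using (Any; here; there)
import Data.List.Relation.Unary.Any.Properties as Any
open import Data.Nat.Base as ℕ using (ℕ; zero; suc)
open import Data.Nat.Induction using (<-wellFounded)
import Data.Nat.Properties as ℕ
open import Data.Product.Base using (Σ-syntax; ∃; _×_; _,_; proj₁; proj₂; uncurry; map₂)
import Data.Product.Properties as Product
open import Data.Sum.Base using (_⊎_; inj₁; inj₂)
import Data.Sum.Properties as Sum
open import Function.Base using (_∘_)
open import Function.Bundles using (mk↣)
open import Induction.WellFounded using (Acc; acc)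
open import Level using (0ℓ)
open import Relation.Binary.Bundles using (TotalOrder)
open import Relation.Binary.Construct.Add.Infimum.NonStrict ℕ._≤_ using (⊥₋≤_; [_])
open import Relation.Binary.Definitions using (DecidableEquality)
open import Relation.Binary.PropositionalEquality using (_≡_; refl; sym; trans; cong)
open import Relation.Nullary using (does; yes; no; ¬?; contradiction)
open import Relation.Nullary.Construct.Add.Infimum using (⊥₋)
open import Relation.Nullary.Decidable using (via-injection)
open import Relation.Unary as Pred using (Pred)

private variable
  m n : ℕ

-- Saturation

-- `P` is never decided: an element enters the collection only as an output of `step`, where
-- `preserves` vouches for it. `bound` serves only for termination.
saturation : {X : Set} → DecidableEquality X → (step : List X → List X)
             (P : Pred X 0ℓ) → (∀ {S} → All P S → All P (step S)) →
             (bound : List X) → P Pred.⊆ (_∈ bound) →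
             ∃ λ S → All P S × All (_∈ S) (step S)
saturation {X} _≟_ step P preserves bound bounded =
  go [] bound (λ px → inj₂ (bounded px)) [] (<-wellFounded _)
  where
  open DecMembership _≟_ using (_∈?_)

  -- `R` holds the candidates not yet collected. By `covers`, a new element `y` outside `S` must
  -- occur in `R`, so deleting it there makes `R` strictly shorter.
  go : ∀ S R → (∀ {x} → P x → x ∈ S ⊎ x ∈ R) → All P S → Acc ℕ._<_ (length R) →
       ∃ λ S → All P S × All (_∈ S) (step S)
  go S R covers sound (acc rec) with All.all? (_∈? S) (step S)
  ... | yes saturated = S , sound , saturated
  ... | no ¬saturated with find (All.¬All⇒Any¬ (_∈? S) (step S) ¬saturated)
  ... | y , y∈step , y∉S = go (y ∷ S) R′ covers′ (py ∷ sound) (rec shrinks)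
    where
    py : P y
    py = All.lookup (preserves sound) y∈step

    ≢y? = λ x → ¬? (x ≟ y)
    R′  = filter ≢y? R

    y∈R : y ∈ R
    y∈R with covers py
    ... | inj₁ y∈S = contradiction y∈S y∉S
    ... | inj₂ y∈R = y∈R

    shrinks : length R′ ℕ.< length R
    shrinks = filter-notAll ≢y? R (Any.map (λ y≡x x≢y → x≢y (sym y≡x)) y∈R)

    covers′ : ∀ {x} → P x → x ∈ y ∷ S ⊎ x ∈ R′
    covers′ {x} px with x ≟ y | covers px
    ... | yes x≡y | _        = inj₁ (here x≡y)
    ... | no  _   | inj₁ x∈S = inj₁ (there x∈S)
    ... | no  x≢y | inj₂ x∈R = inj₂ (∈-filter⁺ ≢y? x∈R x≢y)

-- Decidable equality of atomic constraints

_≟ⁱ_ : DecidableEquality Ineq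
strict ≟ⁱ strict = yes refl
strict ≟ⁱ weak   = no λ ()
weak   ≟ⁱ strict = no λ ()
weak   ≟ⁱ weak   = yes refl

-- Built from sums and products so that decidable equality is inherited, instead of comparing
-- constructors pairwise. In the right summand the Boolean separates upper from lower bounds and the
-- last component separates one clock from two.
Code : ℕ → Set
Code n = Bool ⊎ Bool × Ineq × ℕ × (Fin n ⊎ Fin n × Fin n)

encode : Atomic n → Code n
encode (upper x ◁ c)       = inj₂ (true  , ◁ , c , inj₁ x)
encode (lower c ◁ x)       = inj₂ (false , ◁ , c , inj₁ x)
encode (diffUpper x y ◁ c) = inj₂ (true  , ◁ , c , inj₂ (x , y))
encode (diffLower c ◁ x y) = inj₂ (false , ◁ , c , inj₂ (x , y))
encode ⊤                   = inj₁ true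
encode ⊥                   = inj₁ false

decode : Code n → Atomic n
decode (inj₂ (true  , ◁ , c , inj₁ x))       = upper x ◁ c
decode (inj₂ (false , ◁ , c , inj₁ x))       = lower c ◁ x
decode (inj₂ (true  , ◁ , c , inj₂ (x , y))) = diffUpper x y ◁ c
decode (inj₂ (false , ◁ , c , inj₂ (x , y))) = diffLower c ◁ x y
decode (inj₁ true)                           = ⊤
decode (inj₁ false)                          = ⊥

decode-encode : (φ : Atomic n) → decode (encode φ) ≡ φ
decode-encode (upper x ◁ c)       = refl
decode-encode (lower c ◁ x)       = refl
decode-encode (diffUpper x y ◁ c) = refl
decode-encode (diffLower c ◁ x y) = refl
decode-encode ⊤                   = refl
decode-encode ⊥                   = refl

encode-injective : {φ ψ : Atomic n} → encode φ ≡ encode ψ → φ ≡ ψ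
encode-injective {φ = φ} {ψ} eq =
  trans (sym (decode-encode φ)) (trans (cong decode eq) (decode-encode ψ))

_≟ᵃ_ : DecidableEquality (Atomic n)
_≟ᵃ_ = via-injection (mk↣ encode-injective)
  (Sum.≡-dec Bool._≟_
    (Product.≡-dec Bool._≟_ (Product.≡-dec _≟ⁱ_ (Product.≡-dec ℕ._≟_
      (Sum.≡-dec Fin._≟_ (Product.≡-dec Fin._≟_ Fin._≟_))))))

-- The order ⊑

infix 4 _⊑_

-- This is not entailment: `⊥` lies below everything as well as `⊤`, since neither contributes a
-- constant or a diagonal constraint. In `lower` the two strictness signs are free because `c < d`
-- alone makes the bound weaker.
data _⊑_ {n : ℕ} : Atomic n → Atomic n → Set where
  refl   : ∀ {φ} → φ ⊑ φ
  top    : ∀ {φ} → ⊤ ⊑ φ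
  bot    : ∀ {φ} → ⊥ ⊑ φ
  weaken : ∀ {c x} → lower c weak x ⊑ lower c strict x
  lower  : ∀ {c d ◁ ◁₁ x} → c ℕ.< d → lower c ◁ x ⊑ lower d ◁₁ x

⊑-trans : {φ ψ χ : Atomic n} → φ ⊑ ψ → ψ ⊑ χ → φ ⊑ χ
⊑-trans refl      q         = q
⊑-trans top       _         = top
⊑-trans bot       _         = bot
⊑-trans weaken    refl      = weaken
⊑-trans weaken    (lower q) = lower q
⊑-trans (lower p) refl      = lower p
⊑-trans (lower p) weaken    = lower p
⊑-trans (lower p) (lower q) = lower (ℕ.<-trans p q)

-- Compatibility of `⊑` with inverse updates and with `pre`

truth-⊑ : ∀ a ◁ b {φ : Atomic n} → truth a ◁ b ⊑ φ
truth-⊑ a strict b with does (a ℤ.<? b)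
... | true  = top
... | false = bot
truth-⊑ a weak b with does (a ℤ.≤? b)
... | true  = top
... | false = bot

-- Either the left side already collapses to `⊤`, or `i` is nonnegative; then `j` is positive and
-- both sides remain lower bounds with constants in the same order.
normLower-mono-< : ∀ {i j} ◁ ◁₁ {x : Fin n} → i ℤ.< j →
                   normLower i ◁ x ⊑ normLower j ◁₁ x
normLower-mono-< {i = -[1+ _ ]}           ◁      ◁₁ _       = top
normLower-mono-< {i = + zero}             weak   ◁₁ _       = top
normLower-mono-< {i = + zero} {+ suc _}   strict ◁₁ (+<+ p) = lower p
normLower-mono-< {i = + suc _} {+ suc _}  ◁      ◁₁ (+<+ p) = lower p

normLower-weaken : ∀ i {x : Fin n} → normLower i weak x ⊑ normLower i strict x
normLower-weaken -[1+ _ ]  = top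
normLower-weaken (+ zero)  = top
normLower-weaken (+ suc _) = weaken

-- Only lower bounds on one clock `x` need work. If `up x` is a constant, the smaller side becomes
-- trivial; if it is `y ⊕ d`, both constants shift by the same amount.
⁻¹-mono : ∀ (up : Update n) {χ φ} → χ ⊑ φ → up ⁻¹ χ ⊑ up ⁻¹ φ
⁻¹-mono up refl = refl
⁻¹-mono up top  = top
⁻¹-mono up bot  = bot
⁻¹-mono up (weaken {c} {x}) with up x
... | const a = truth-⊑ (+ c) weak (+ a)
... | y ⊕ d   = normLower-weaken (+ c ℤ.- d)
⁻¹-mono up (lower {c} {◁ = ◁} {◁₁} {x} p) with up x
... | const a = truth-⊑ (+ c) ◁ (+ a)
... | y ⊕ d   = normLower-mono-< ◁ ◁₁ (ℤ.+-monoˡ-< (ℤ.- d) (+<+ p))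

-- Any constant that rule `lower` may pick is below `d`, so the choice left open in `pre` does not
-- matter; the other rules return `⊤`.
reduces-⊑ : ∀ {g} {ψ χ : Atomic n} → Reduces g ψ χ → χ ⊑ ψ
reduces-⊑ (upper _)     = top
reduces-⊑ (lower _ c<d) = lower c<d
reduces-⊑ (diffUpper _) = top
reduces-⊑ (diffLower _) = top

pre-⊑ : ∀ {pre} → IsPre {n} pre → ∀ φ g up → pre φ g up ⊑ up ⁻¹ φ
pre-⊑ {pre = pre} isPre φ g up with pre φ g up | isPre φ g up
... | _ | inj₁ reduces    = reduces-⊑ reduces
... | _ | inj₂ (_ , refl) = refl

-- Every constructor except `refl` has `⊤`, `⊥` or a lower bound on its left.
⊑-diagonal : {χ φ : Atomic n} → χ ⊑ φ → Diagonal χ → χ ≡ φ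
⊑-diagonal refl _ = refl

module ℕ₋∞ = TotalOrder ℕ₋∞

lowerConst-mono : ∀ (x : Fin n) {χ φ} → χ ⊑ φ → lowerConst x χ ≤₋∞ lowerConst x φ
lowerConst-mono x refl   = ℕ₋∞.refl
lowerConst-mono x top    = ⊥₋≤ _
lowerConst-mono x bot    = ⊥₋≤ _
lowerConst-mono x weaken = ℕ₋∞.refl
lowerConst-mono x (lower {x = y} c<d) with does (x Fin.≟ y)
... | true  = [ ℕ.<⇒≤ c<d ]
... | false = ⊥₋≤ _

upperConst-mono : ∀ (x : Fin n) {χ φ} → χ ⊑ φ → upperConst x χ ≤₋∞ upperConst x φ
upperConst-mono x refl      = ℕ₋∞.refl
upperConst-mono x top       = ⊥₋≤ _
upperConst-mono x bot       = ⊥₋≤ _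
upperConst-mono x weaken    = ⊥₋≤ _
upperConst-mono x (lower _) = ⊥₋≤ _

-- Down-closures

↓_ : Family m n → Family m n
(↓ 𝒢) q χ = ∃ λ φ → 𝒢 q φ × χ ⊑ φ

-- For `χ ⊑ φ` with `φ` in `𝒢`, the chain `pre χ ⊑ up ⁻¹ χ ⊑ up ⁻¹ φ` ends in `𝒢`. The guard thus
-- reduces only `χ`, never the witness `φ`.
↓-isReducedGMap : ∀ (A : UTA m n) {pre 𝒢} → IsPre pre → IsGMap A 𝒢 →
                  IsReducedGMap A pre (↓ 𝒢)
↓-isReducedGMap A isPre isGMap = record
  { guards = λ t∈ → All.map (λ φ∈ → _ , φ∈ , refl) (guards t∈)
  ; nonneg = λ t∈ x → _ , nonneg t∈ x , pre-⊑ isPre _ _ _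
  ; closed = λ { t∈ (_ , φ∈ , χ⊑φ) →
      _ , closed t∈ φ∈ , ⊑-trans (pre-⊑ isPre _ _ _) (⁻¹-mono _ χ⊑φ) }
  }
  where open IsClosed isGMap

-- An over-approximation, as only a bound is wanted: both signs are listed for every constant. The
-- range runs to `suc c` exclusive because `weaken` keeps the constant `c`.
lowers : Atomic n → List (Atomic n)
lowers (lower c _ x) =
  cartesianProductWith (λ k ◁₁ → lower k ◁₁ x) (upTo (suc c)) (strict ∷ weak ∷ [])
lowers _             = []

downset : Atomic n → List (Atomic n)
downset φ = ⊤ ∷ ⊥ ∷ φ ∷ lowers φ

∈-downset : {χ φ : Atomic n} → χ ⊑ φ → χ ∈ downset φ
∈-downset top    = here refl
∈-downset bot    = there (here refl)
∈-downset refl   = there (there (here refl))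
∈-downset (weaken {x = x}) = there (there (there
  (∈-cartesianProductWith⁺ (λ k ◁ → lower k ◁ x) (∈-upTo⁺ ℕ.≤-refl) (there (here refl)))))
∈-downset (lower {◁ = ◁} {x = x} c<d) = there (there (there
  (∈-cartesianProductWith⁺ (λ k ◁₁ → lower k ◁₁ x) (∈-upTo⁺ (ℕ.m<n⇒m<1+n c<d)) (∈-ineqs ◁))))
  where
  ∈-ineqs : ∀ ◁ → ◁ ∈ strict ∷ weak ∷ []
  ∈-ineqs strict = here refl
  ∈-ineqs weak   = there (here refl)

module _ {G : Pred (Atomic n) 0ℓ} (fin : Finite G) where

  ⊑-finite-bound : ∃ λ xs → ∀ {χ φ} → G φ → χ ⊑ φ → χ ∈ xs
  ⊑-finite-bound = concatMap downset (proj₁ fin) , λ φ∈G χ⊑φ →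
    ∈-concatMap⁺ downset
      (Any.map (λ { refl → ∈-downset χ⊑φ }) (proj₁ (proj₂ fin) φ∈G))

  open Extrema ℕ₋∞ using (max; max[xs]≤max[ys]⁺)

  -- Each entry listed for `H` is dominated by an entry listed for `G`, which suffices for the
  -- maxima, whatever the order or repetitions in the lists. Leaving `f` general covers `L` and `U`
  -- at once.
  max-mono-⊑ : ∀ {f} → (∀ {χ φ : Atomic n} → χ ⊑ φ → f χ ≤₋∞ f φ) →
               {H : Pred (Atomic n) 0ℓ} (finH : Finite H) →
               (∀ {χ} → H χ → ∃ λ φ → G φ × χ ⊑ φ) →
               max ⊥₋ (map f (proj₁ finH)) ≤₋∞ max ⊥₋ (map f (proj₁ fin))
  max-mono-⊑ {f} mono (_ , _ , H⊇) below = max[xs]≤max[ys]⁺ ⊥₋ _ (inj₁ ℕ₋∞.refl)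
    (All.map⁺ (All.tabulate λ χ∈ → inj₂ (Any.map⁺ (dominated (below (H⊇ χ∈))))))
    where
    dominated : ∀ {χ} → ∃ (λ φ → G φ × χ ⊑ φ) → Any (λ φ → f χ ≤₋∞ f φ) (proj₁ fin)
    dominated (_ , φ∈G , χ⊑φ) =
      Any.map (λ { refl → mono χ⊑φ }) (proj₁ (proj₂ fin) φ∈G)

-- Enumeration of smallest families

-- A finite family is stored as a single list of pairs, since transitions link the constraints of
-- different states and all must be saturated together.
_at_ : List (Fin m × Atomic n) → Fin m → List (Atomic n)
S at q = map proj₂ (filter (λ s → proj₁ s Fin.≟ q) S)

module _ {S : List (Fin m × Atomic n)} {q : Fin m} where

  ∈-at⁺ : ∀ {φ} → (q , φ) ∈ S → φ ∈ S at q
  ∈-at⁺ φ∈ = ∈-map∘filter⁺ proj₂ (λ s → proj₁ s Fin.≟ q) (_ , φ∈ , refl , refl)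

  ∈-at⁻ : ∀ {φ} → φ ∈ S at q → (q , φ) ∈ S
  ∈-at⁻ φ∈ with ∈-map∘filter⁻ proj₂ (λ s → proj₁ s Fin.≟ q) φ∈
  ... | _ , s∈ , refl , refl = s∈

module _ (A : UTA m n) (back : Atomic n → Guard n → Update n → Atomic n) where
  open UTA A
  open Transition

  -- The three blocks answer to the fields `guards`, `nonneg` and `closed`, so being saturated under
  -- `step` amounts to being closed.
  consequences : List (Fin m × Atomic n) → Transition m n → List (Atomic n)
  consequences S t =
    guard t ++
    map (λ x → back (lower 0 weak x) (guard t) (update t)) (allFin n) ++
    map (λ φ → back φ (guard t) (update t)) (S at target t)

  step : List (Fin m × Atomic n) → List (Fin m × Atomic n)
  step S = concatMap (λ t → map (source t ,_) (consequences S t)) transitions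

  step-sound : ∀ {𝒢} → IsClosed A back 𝒢 →
               ∀ {S} → All (uncurry 𝒢) S → All (uncurry 𝒢) (step S)
  step-sound isClosed sound = All.concat⁺ (All.map⁺ (All.tabulate λ t∈ → All.map⁺
    (All.++⁺ (guards t∈) (All.++⁺
      (All.map⁺ (All.tabulate λ {x} _ → nonneg t∈ x))
      (All.map⁺ (All.tabulate λ φ∈ → closed t∈ (All.lookup sound (∈-at⁻ φ∈))))))))
    where open IsClosed isClosed

  saturated-isClosed : ∀ {S} → All (_∈ S) (step S) →
                       IsClosed A back (λ q φ → (q , φ) ∈ S)
  saturated-isClosed {S} saturated = record
    { guards = proj₁ ∘ parts
    ; nonneg = λ t∈ x → All.lookup (All.map⁻ (proj₁ (proj₂ (parts t∈)))) (∈-allFin x)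
    ; closed = λ t∈ φ∈ → All.lookup (All.map⁻ (proj₂ (proj₂ (parts t∈)))) (∈-at⁺ φ∈)
    }
    where
    Saturated : Transition m n → List (Atomic n) → Set
    Saturated t = All (λ φ → (source t , φ) ∈ S)

    parts : ∀ {t} → t ∈ transitions →
            Saturated t (guard t) ×
            Saturated t (map (λ x → back (lower 0 weak x) (guard t) (update t)) (allFin n)) ×
            Saturated t (map (λ φ → back φ (guard t) (update t)) (S at target t))
    parts {t} t∈ = map₂ (All.++⁻ _) (All.++⁻ (guard t)
      (All.map⁻ (All.lookup (All.map⁻ (All.concat⁻ saturated)) t∈)))

  -- A list covering `𝒢 q` does not yet enumerate it. The saturated `S` does: it is closed, so
  -- minimality puts `𝒢` inside it, and soundness puts it inside `𝒢`.
  smallest-finite : ∀ {𝒢} → IsSmallest (IsClosed A back) 𝒢 →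
                    (∀ q → ∃ λ xs → 𝒢 q Pred.⊆ (_∈ xs)) → FiniteFamily 𝒢
  smallest-finite {𝒢} (isClosed , least) bound q
    with saturation (Product.≡-dec Fin._≟_ _≟ᵃ_) step (uncurry 𝒢)
           (step-sound isClosed) universe bounded
    where
    universe : List (Fin m × Atomic n)
    universe = concatMap (λ q → map (q ,_) (proj₁ (bound q))) (allFin m)

    bounded : uncurry 𝒢 Pred.⊆ (_∈ universe)
    bounded {q , _} φ∈ = ∈-concatMap⁺ _
      (Any.map (λ { refl → ∈-map⁺ (q ,_) (proj₂ (bound q) φ∈) }) (∈-allFin q))
  ... | S , sound , saturated =
    S at q , ∈-at⁺ ∘ least _ (saturated-isClosed saturated) q
           , All.lookup sound ∘ ∈-at⁻

theorem18 : ∀ {m n : ℕ} (A : UTA m n)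
    (pre : Atomic n → Guard n → Update n → Atomic n) → IsPre pre →
    (𝒢₁ 𝒢₂ : Family m n) →
    IsSmallest (IsGMap A) 𝒢₁ →
    IsSmallest (IsReducedGMap A pre) 𝒢₂ →
    (fin₁ : FiniteFamily 𝒢₁) →
    Σ[ fin₂ ∈ FiniteFamily 𝒢₂ ] (LU≤ fin₂ fin₁ × (𝒢₂ ⊆ᵈ 𝒢₁))
theorem18 A pre isPre 𝒢₁ 𝒢₂ (isGMap , _) smallest@(_ , least) fin₁ =
  fin₂ ,
  (λ q x → max-mono-⊑ (fin₁ q) (lowerConst-mono x) (fin₂ q) (below q) ,
           max-mono-⊑ (fin₁ q) (upperConst-mono x) (fin₂ q) (below q)) ,
  diagonal
  where
  -- Minimality of `𝒢₂` is applied to the down-closure; the bound for finiteness, the comparison of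
  -- constants and the diagonal inclusion are all read off from the result.
  below : ∀ q → 𝒢₂ q Pred.⊆ (↓ 𝒢₁) q
  below = least (↓ 𝒢₁) (↓-isReducedGMap A isPre isGMap)

  fin₂ : FiniteFamily 𝒢₂
  fin₂ = smallest-finite A pre smallest λ q →
    map₂ (λ bound χ∈ → let _ , φ∈ , χ⊑φ = below q χ∈ in bound φ∈ χ⊑φ)
         (⊑-finite-bound (fin₁ q))

  diagonal : 𝒢₂ ⊆ᵈ 𝒢₁
  diagonal q (χ∈ , isDiagonal) with below q χ∈
  ... | _ , φ∈ , χ⊑φ with ⊑-diagonal χ⊑φ isDiagonal
  ... | refl = φ∈ , isDiagonal
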